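{- Let $\alpha\in\mathbf{For}$ be a formula. Then $\alpha$ is valid in every relational model (that is, $\alpha$ is true in every $HT$-model) if and only if $\alpha$ is algebraically valid (that is, $h(\alpha)=1$ for every algebraic model $(A,h)$).
   Context: Language. $\mathbf{VarProp}$ is a countable set of propositional variables. $\mathbf{For}$ is the least set containing $\mathbf{VarProp}$ and closed under the binary connectives $\wedge,\vee,\Rightarrow$ and the unary connectives $\neg,S_1,S_2$ (the freely generated set of formulas). HT-algebras. An $HT$-algebra is an algebra $A=(A,0,1,\wedge,\vee,\Rightarrow,\neg,S_1,S_2)$ such that $(A,0,1,\wedge,\vee,\Rightarrow,\neg)$ is a Heyting algebra (with $\neg a=a\Rightarrow 0$), and for all $a,b\in A$ and all $i,j\in\{1,2\}$: $S_i(a\wedge b)=S_ia\wedge S_ib$; $S_i(a\vee b)=S_ia\vee S_ib$; $S_2(a\Rightarrow b)=(S_2a\Rightarrow S_2b)$; $S_1(a\Rightarrow b)=(S_1a\Rightarrow S_1b)\wedge(S_2a\Rightarrow S_2b)$; $S_iS_ja=S_ja$; $S_1a\vee a=a$; $S_1a\vee\neg S_1a=1$. Algebraic semantics. An algebraic model is a pair $(A,h)$ where $A$ is an $HT$-algebra and $h:\mathbf{For}\to A$ is a homomorphism, i.e. $h$ preserves $\wedge,\vee,\Rightarrow,\neg,S_1,S_2$. Relational semantics. An $HT$-frame is a system $K=(W,R,s_1,s_2)$ where (K0) $W$ is a nonempty set, $R$ is a binary relation on $W$, and $s_1,s_2:W\to W$ are functions, and for all $w,w'\in W$ and $i,j\in\{1,2\}$: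 (K1) $R$ is reflexive and transitive; (K2) $s_j(s_i(w))=s_j(w)$; (K3) $R(s_1(w),w)$; (K4) $R(w,s_2(w))$; (K5) $R(w,w')$ implies $R(s_i(w),s_i(w'))$ and $R(s_i(w'),s_i(w))$; (K6) for every $w\in W$ there are $i\in\{1,2\}$ and $w'\in W$ with $w=s_i(w')$. An $HT$-model based on $K$ is $M=(K,m)$ where $m:\mathbf{VarProp}\to\mathcal P(W)$ satisfies: $R(w,w')$ and $w\in m(p)$ imply $w'\in m(p)$. Satisfaction $M,w\ sat\ \alpha$ is defined recursively: $M,w\ sat\ p$ iff $w\in m(p)$; $M,w\ sat\ \alpha\wedge\beta$ iff $M,w\ sat\ \alpha$ and $M,w\ sat\ \beta$; $M,w\ sat\ \alpha\vee\beta$ iff $M,w\ sat\ \alpha$ or $M,w\ sat\ \beta$; $M,w\ sat\ \alpha\Rightarrow\beta$ iff for all $w'$, if $R(w,w')$ and $M,w'\ sat\ \alpha$ then $M,w'\ sat\ \beta$; $M,w\ sat\ \neg\alpha$ iff for all $w'$ with $R(w,w')$, not $M,w'\ sat\ \alpha$; $M,w\ sat\ S_i\alpha$ iff $M,s_i(w)\ sat\ \alpha$. A formula $\alpha$ is true in $M$ iff $M,w\ sat\ \alpha$ for every $w\in W$. -}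

module Defs where

open import Data.Product using (_×_; ∃₂)
open import Data.Sum using (_⊎_)
open import Level using (Level; _⊔_; suc)
open import Relation.Binary.Core using (Rel)
open import Relation.Binary.Definitions using (Reflexive; Transitive)
open import Relation.Binary.Lattice.Bundles using (HeytingAlgebra)
import Relation.Binary.Lattice.Properties.HeytingAlgebra as HeytingProperties
open import Relation.Binary.PropositionalEquality using (_≡_)
open import Relation.Nullary using (¬_)
open import Relation.Unary using (Pred; _∈_)

data Index : Set where
  𝟏 𝟐 : Index

infixr 7 _∧ᶠ_
infixr 6 _∨ᶠ_
infixr 5 _⇒ᶠ_
infix  8 ¬ᶠ_

data For (VarProp : Set) : Set where
  var            : VarProp → For VarProp
  _∧ᶠ_ _∨ᶠ_ _⇒ᶠ_ : For VarProp → For VarProp → For VarProp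
  ¬ᶠ_            : For VarProp → For VarProp
  Sᶠ             : Index → For VarProp → For VarProp

-- Equations hold up to the setoid equality _≈_ of the underlying algebra,
-- so the operations S i have to respect it.
record HTAlgebra (c ℓ₁ ℓ₂ : Level) : Set (suc (c ⊔ ℓ₁ ⊔ ℓ₂)) where
  field
    heytingAlgebra : HeytingAlgebra c ℓ₁ ℓ₂

  open HeytingAlgebra heytingAlgebra public
  open HeytingProperties heytingAlgebra public using () renaming (¬_ to infix 8 ∼_)

  field
    S      : Index → Carrier → Carrier
    S-cong : ∀ i {a b} → a ≈ b → S i a ≈ S i b
    S-∧    : ∀ i a b → S i (a ∧ b) ≈ S i a ∧ S i b
    S-∨    : ∀ i a b → S i (a ∨ b) ≈ S i a ∨ S i b
    S₂-⇨   : ∀ a b → S 𝟐 (a ⇨ b) ≈ (S 𝟐 a ⇨ S 𝟐 b)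
    S₁-⇨   : ∀ a b → S 𝟏 (a ⇨ b) ≈ (S 𝟏 a ⇨ S 𝟏 b) ∧ (S 𝟐 a ⇨ S 𝟐 b)
    S-S    : ∀ i j a → S i (S j a) ≈ S j a
    S₁-∨   : ∀ a → S 𝟏 a ∨ a ≈ a
    S₁-lem : ∀ a → S 𝟏 a ∨ ∼ S 𝟏 a ≈ ⊤

record AlgebraicModel (VarProp : Set) (c ℓ₁ ℓ₂ : Level) : Set (suc (c ⊔ ℓ₁ ⊔ ℓ₂)) where
  field
    algebra : HTAlgebra c ℓ₁ ℓ₂

  open HTAlgebra algebra public

  field
    h   : For VarProp → Carrier
    h-∧ : ∀ α β → h (α ∧ᶠ β) ≈ h α ∧ h β
    h-∨ : ∀ α β → h (α ∨ᶠ β) ≈ h α ∨ h β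
    h-⇒ : ∀ α β → h (α ⇒ᶠ β) ≈ (h α ⇨ h β)
    h-¬ : ∀ α → h (¬ᶠ α) ≈ ∼ h α
    h-S : ∀ i α → h (Sᶠ i α) ≈ S i (h α)

AlgebraicallyValid : ∀ {VarProp : Set} (c ℓ₁ ℓ₂ : Level) → For VarProp → Set (suc (c ⊔ ℓ₁ ⊔ ℓ₂))
AlgebraicallyValid {VarProp} c ℓ₁ ℓ₂ α =
  (M : AlgebraicModel VarProp c ℓ₁ ℓ₂) → let open AlgebraicModel M in h α ≈ ⊤

record HTFrame (ℓ : Level) : Set (suc ℓ) where
  field
    W        : Set ℓ
    nonempty : W
    R        : Rel W ℓ
    s        : Index → W → W
    R-refl   : Reflexive R
    R-trans  : Transitive R
    s-s      : ∀ i j w → s j (s i w) ≡ s j w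
    s₁-R     : ∀ w → R (s 𝟏 w) w
    R-s₂     : ∀ w → R w (s 𝟐 w)
    s-R      : ∀ i {w w′} → R w w′ → R (s i w) (s i w′) × R (s i w′) (s i w)
    s-cover  : ∀ w → ∃₂ λ i w′ → w ≡ s i w′

record HTModel (VarProp : Set) (ℓ : Level) : Set (suc ℓ) where
  field
    frame : HTFrame ℓ

  open HTFrame frame public

  field
    m         : VarProp → Pred W ℓ
    m-persist : ∀ p {w w′} → R w w′ → w ∈ m p → w′ ∈ m p

infix 4 _,_sat_

_,_sat_ : ∀ {VarProp : Set} {ℓ : Level} (M : HTModel VarProp ℓ) → HTModel.W M → For VarProp → Set ℓ
M , w sat var p    = w ∈ HTModel.m M p
M , w sat (α ∧ᶠ β) = (M , w sat α) × (M , w sat β)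
M , w sat (α ∨ᶠ β) = (M , w sat α) ⊎ (M , w sat β)
M , w sat (α ⇒ᶠ β) = ∀ w′ → HTModel.R M w w′ → M , w′ sat α → M , w′ sat β
M , w sat (¬ᶠ α)   = ∀ w′ → HTModel.R M w w′ → ¬ (M , w′ sat α)
M , w sat Sᶠ i α   = M , HTModel.s M i w sat α

TrueIn : ∀ {VarProp : Set} {ℓ : Level} → HTModel VarProp ℓ → For VarProp → Set ℓ
TrueIn M α = ∀ w → M , w sat α

RelationallyValid : ∀ {VarProp : Set} (ℓ : Level) → For VarProp → Set (suc ℓ)
RelationallyValid {VarProp} ℓ α = (M : HTModel VarProp ℓ) → TrueIn M α

{-# OPTIONS --safe #-}

-- Up to mutual accessibility, a frame is a disjoint union of two-element chains s₁ w ≤ s₂ w, and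
-- the truth values of a formula at s₁ w and s₂ w depend only on those of its variables.  On the
-- algebraic side, S₁ a and S₂ a are complemented.  Hence an element d lying below S i (h p) or
-- below its complement, for each variable p of α and each i, also lies below S i (h α) or its
-- complement, and the truth values of α decide which (the truth lemma).
-- If α is relationally valid, then ⊤ is the join of finitely many such d (one for each three-valued
-- valuation of the variables of α), each below S₁ (h α) ≤ h α by validity in a two-world model.
-- Conversely, excluded middle turns a world of a relational model into a homomorphism to the
-- three-element algebra, where the truth lemma is applied with d = ⊤.
module Submission where

open import Defs
open import Axiom.ExcludedMiddle using (ExcludedMiddle)
open import Data.Empty using () renaming (⊥ to Empty)
open import Data.List using (List; []; _∷_; _++_)
open import Data.List.Relation.Unary.All as All using (All; []; _∷_)
open import Data.List.Relation.Unary.All.Properties using (++⁻ˡ; ++⁻ʳ)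
open import Data.Nat using (ℕ)
import Data.Nat.Properties as ℕ
open import Data.Product using (_×_; _,_; proj₁; proj₂; map₂)
open import Data.Sum as Sum using (_⊎_; inj₁; inj₂; [_,_]′)
open import Function using (id; _∘_)
open import Function.Bundles using (_↣_; _⇔_; mk⇔; module Equivalence)
open import Level using (Level; Lift; lift; lower)
open import Relation.Binary.Definitions using (DecidableEquality)
open import Relation.Binary.Lattice.Bundles using (HeytingAlgebra)
import Relation.Binary.Lattice.Properties.HeytingAlgebra as HeytingProperties
import Relation.Binary.Lattice.Properties.JoinSemilattice as JoinProperties
open import Relation.Binary.PropositionalEquality as ≡ using (_≡_; refl; subst; subst₂)
open import Relation.Nullary using (¬_; Dec; yes; no; contradiction)
open import Relation.Nullary.Decidable using (via-injection)

private variable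
  ℓ c ℓ₁ ℓ₂ p q : Level
  VarProp : Set

-- Complemented elements of HT-algebras and decided propositions

module HTAlgebraProperties (A : HTAlgebra c ℓ₁ ℓ₂) where
  open HTAlgebra A renaming (trans to ≤-trans; refl to ≤-refl)
  open HeytingProperties heytingAlgebra hiding (¬_)
  open JoinProperties joinSemilattice using (∨-monotonic)

  S₁≤ : ∀ a → S 𝟏 a ≤ a
  S₁≤ a = ≤-trans (x≤x∨y _ _) (reflexive (S₁-∨ a))

  -- Since `S 𝟏 ⊥` lies below `⊥`, `⊥` is in the image of `S 𝟏`, which `S-S` says every `S i` fixes.
  S-⊥ : ∀ i → S i ⊥ ≈ ⊥
  S-⊥ i = Eq.trans (S-cong i (Eq.sym S₁⊥≈⊥)) (Eq.trans (S-S i 𝟏 ⊥) S₁⊥≈⊥)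
    where
    S₁⊥≈⊥ : S 𝟏 ⊥ ≈ ⊥
    S₁⊥≈⊥ = antisym (S₁≤ ⊥) (minimum _)

  -- `S₁-lem` covers `S 𝟏` only, but `S i a` is itself fixed by `S 𝟏`.
  S-complemented : ∀ i a → ⊤ ≤ S i a ∨ ∼ S i a
  S-complemented i a = ≤-trans (reflexive (Eq.sym (S₁-lem (S i a))))
    (∨-monotonic (reflexive S₁S) (⇨ˡ-contravariant (reflexive (Eq.sym S₁S))))
    where
    S₁S : S 𝟏 (S i a) ≈ S i a
    S₁S = S-S 𝟏 i a

  -- `S 𝟐` preserves joins, hence order; applied to `S 𝟏 a ≤ a` it leaves the left side unchanged.
  S₁≤S₂ : ∀ a → S 𝟏 a ≤ S 𝟐 a
  S₁≤S₂ a = ≤-trans (≤-trans (reflexive (Eq.sym (S-S 𝟐 𝟏 a))) (y≤x∨y (S 𝟐 a) _))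
    (reflexive (Eq.trans (Eq.sym (S-∨ 𝟐 a (S 𝟏 a)))
      (S-cong 𝟐 (antisym (∨-least ≤-refl (S₁≤ a)) (x≤x∨y _ _)))))

  case-split : ∀ {b} → ⊤ ≤ b ∨ ∼ b → ∀ {d x} → d ∧ b ≤ x → d ∧ ∼ b ≤ x → d ≤ x
  case-split b∨∼b d∧b≤x d∧∼b≤x =
    ≤-trans (∧-greatest ≤-refl (≤-trans (maximum _) (≤-trans b∨∼b
      (∨-least (swap-transpose-⇨ d∧b≤x) (swap-transpose-⇨ d∧∼b≤x)))))
    (⇨-applyʳ ≤-refl)

  -- The truth of `P` is recorded next to the inequality because for small `d`, such as `⊥`, both
  -- `d ≤ x` and `d ≤ ∼ x` hold.
  Decides : Carrier → Set p → Carrier → Set _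
  Decides d P x = (P × d ≤ x) ⊎ (¬ P × d ≤ ∼ x)

  private variable
    d e x y : Carrier
    P : Set p
    Q : Set q

  decides-antitone : e ≤ d → Decides d P x → Decides e P x
  decides-antitone e≤d = Sum.map (map₂ (≤-trans e≤d)) (map₂ (≤-trans e≤d))

  decides-resp : P ⇔ Q → x ≈ y → Decides d P x → Decides d Q y
  decides-resp P⇔Q x≈y = Sum.map
    (λ (a , d≤x) → to a , ≤-trans d≤x (reflexive x≈y))
    (λ (¬a , d≤∼x) → ¬a ∘ from , ≤-trans d≤∼x (⇨ˡ-contravariant (reflexive (Eq.sym x≈y))))
    where open Equivalence P⇔Q

  decides-⊥ : Decides d Empty ⊥
  decides-⊥ = inj₂ (id , transpose-⇨ (x∧y≤y _ _))

  decides-× : Decides d P x → Decides d Q y → Decides d (P × Q) (x ∧ y)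
  decides-× (inj₁ (a , d≤x)) (inj₁ (b , d≤y)) = inj₁ ((a , b) , ∧-greatest d≤x d≤y)
  decides-× (inj₁ _) (inj₂ (¬b , d≤∼y)) =
    inj₂ (¬b ∘ proj₂ , ≤-trans d≤∼y (⇨ˡ-contravariant (x∧y≤y _ _)))
  decides-× (inj₂ (¬a , d≤∼x)) _ =
    inj₂ (¬a ∘ proj₁ , ≤-trans d≤∼x (⇨ˡ-contravariant (x∧y≤x _ _)))

  decides-⊎ : Decides d P x → Decides d Q y → Decides d (P ⊎ Q) (x ∨ y)
  decides-⊎ (inj₁ (a , d≤x)) _ = inj₁ (inj₁ a , ≤-trans d≤x (x≤x∨y _ _))
  decides-⊎ (inj₂ _) (inj₁ (b , d≤y)) = inj₁ (inj₂ b , ≤-trans d≤y (y≤x∨y _ _))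
  decides-⊎ (inj₂ (¬a , d≤∼x)) (inj₂ (¬b , d≤∼y)) =
    inj₂ ([ ¬a , ¬b ]′ , ≤-trans (∧-greatest d≤∼x d≤∼y) (⇨-distribˡ-∨-∧-≥ _ _ _))

  decides-→ : Decides d P x → Decides d Q y → Decides d (P → Q) (x ⇨ y)
  decides-→ _ (inj₁ (b , d≤y)) = inj₁ ((λ _ → b) , ≤-trans d≤y y≤x⇨y)
  decides-→ (inj₁ (a , d≤x)) (inj₂ (¬b , d≤∼y)) =
    inj₂ ((λ f → ¬b (f a)) , transpose-⇨
      (≤-trans (∧-greatest (≤-trans (x∧y≤x _ _) d≤∼y) (⇨-applyʳ d≤x)) ⇨-eval))
  decides-→ (inj₂ (¬a , d≤∼x)) (inj₂ _) =
    inj₁ ((λ a → contradiction a ¬a) , ≤-trans d≤∼x (⇨ʳ-covariant (minimum _)))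

-- Frames as unions of two-element chains

module HTFrameProperties (F : HTFrame ℓ) where
  open HTFrame F

  s₁-R-s₂ : ∀ w → R (s 𝟏 w) (s 𝟐 w)
  s₁-R-s₂ w = R-trans (s₁-R w) (R-s₂ w)

  s₂-maximal : ∀ {w w′} → R (s 𝟐 w) w′ → R w′ (s 𝟐 w)
  s₂-maximal {w} {w′} r = R-trans (R-s₂ w′) (subst (R _) (s-s 𝟐 𝟐 w) (proj₂ (s-R 𝟐 r)))

  -- By `s-cover`, `w′` is some `s i v`. Applying `s i` to the given relation makes it symmetric by
  -- `s-R`, and `s-s` collapses the iterated maps.
  above-s₁ : ∀ {w w′} → R (s 𝟏 w) w′ → (R (s 𝟏 w) w′ × R w′ (s 𝟏 w)) ⊎ (R (s 𝟐 w) w′ × R w′ (s 𝟐 w))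
  above-s₁ {w} {w′} r with s-cover w′
  ... | 𝟏 , v , refl = inj₁ (subst₂ (λ x y → R x y × R y x) (s-s 𝟏 𝟏 w) (s-s 𝟏 𝟏 v) (s-R 𝟏 r))
  ... | 𝟐 , v , refl = inj₂ (subst₂ (λ x y → R x y × R y x) (s-s 𝟏 𝟐 w) (s-s 𝟐 𝟐 v) (s-R 𝟐 r))

  Persistent : (W → Set p) → Set _
  Persistent P = ∀ {w w′} → R w w′ → P w → P w′

  Implies : (W → Set p) → (W → Set q) → W → Set _
  Implies P Q w = ∀ w′ → R w w′ → P w′ → Q w′

  module _ {P : W → Set p} {Q : W → Set q} (P↑ : Persistent P) (Q↑ : Persistent Q) (w : W) where

    -- Persistent predicates agree at mutually accessible worlds, so it suffices to test an
    -- implication on the chain. The two equivalences mirror `S₂-⇨` and `S₁-⇨`.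
    implies-s₂ : (P (s 𝟐 w) → Q (s 𝟐 w)) ⇔ Implies P Q (s 𝟐 w)
    implies-s₂ = mk⇔ (λ f w′ r → Q↑ r ∘ f ∘ P↑ (s₂-maximal r)) (λ f → f _ R-refl)

    implies-s₁ : ((P (s 𝟏 w) → Q (s 𝟏 w)) × (P (s 𝟐 w) → Q (s 𝟐 w))) ⇔ Implies P Q (s 𝟏 w)
    implies-s₁ = mk⇔
      (λ (f , g) w′ r → [ (λ (r₁ , r₂) → Q↑ r₁ ∘ f ∘ P↑ r₂) , (λ (r₁ , r₂) → Q↑ r₁ ∘ g ∘ P↑ r₂) ]′
                          (above-s₁ r))
      (λ f → f _ R-refl , f _ (s₁-R-s₂ w))

sat-persistent : (M : HTModel VarProp ℓ) (α : For VarProp) →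
                 ∀ {w w′} → HTModel.R M w w′ → M , w sat α → M , w′ sat α
sat-persistent M (var p) r = HTModel.m-persist M p r
sat-persistent M (α ∧ᶠ β) r (a , b) = sat-persistent M α r a , sat-persistent M β r b
sat-persistent M (α ∨ᶠ β) r = Sum.map (sat-persistent M α r) (sat-persistent M β r)
sat-persistent M (α ⇒ᶠ β) r f w r′ = f w (HTModel.R-trans M r r′)
sat-persistent M (¬ᶠ α) r f w r′ = f w (HTModel.R-trans M r r′)
sat-persistent M (Sᶠ i α) r = sat-persistent M α (proj₁ (HTModel.s-R M i r))

-- The truth lemma

vars : For VarProp → List VarProp
vars (var p) = p ∷ []
vars (α ∧ᶠ β) = vars α ++ vars β
vars (α ∨ᶠ β) = vars α ++ vars β
vars (α ⇒ᶠ β) = vars α ++ vars β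
vars (¬ᶠ α) = vars α
vars (Sᶠ i α) = vars α

module TruthLemma (M : HTModel VarProp ℓ) (w : HTModel.W M) (A : AlgebraicModel VarProp c ℓ₁ ℓ₂) where
  open HTModel M using (W; s; s-s; frame)
  open HTFrameProperties frame
  open AlgebraicModel A hiding (refl)
  open HTAlgebraProperties algebra

  DecidesAt : Carrier → (W → Set p) → Carrier → Set _
  DecidesAt d P a = ∀ i → Decides d (P (s i w)) (S i a)

  decides-implies : ∀ {d a b} {P : W → Set p} {Q : W → Set q} → Persistent P → Persistent Q →
                    DecidesAt d P a → DecidesAt d Q b → DecidesAt d (Implies P Q) (a ⇨ b)
  decides-implies P↑ Q↑ D E 𝟏 =
    decides-resp (implies-s₁ P↑ Q↑ w) (Eq.sym (S₁-⇨ _ _))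
      (decides-× (decides-→ (D 𝟏) (E 𝟏)) (decides-→ (D 𝟐) (E 𝟐)))
  decides-implies P↑ Q↑ D E 𝟐 =
    decides-resp (implies-s₂ P↑ Q↑ w) (Eq.sym (S₂-⇨ _ _)) (decides-→ (D 𝟐) (E 𝟐))

  truth : ∀ {d} α → All (λ p → DecidesAt d (M ,_sat var p) (h (var p))) (vars α) →
          DecidesAt d (M ,_sat α) (h α)
  truth (var p) (D ∷ []) = D
  truth (α ∧ᶠ β) D i =
    decides-resp (mk⇔ id id) (Eq.sym (Eq.trans (S-cong i (h-∧ α β)) (S-∧ i _ _)))
      (decides-× (truth α (++⁻ˡ (vars α) D) i) (truth β (++⁻ʳ (vars α) D) i))
  truth (α ∨ᶠ β) D i =
    decides-resp (mk⇔ id id) (Eq.sym (Eq.trans (S-cong i (h-∨ α β)) (S-∨ i _ _)))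
      (decides-⊎ (truth α (++⁻ˡ (vars α) D) i) (truth β (++⁻ʳ (vars α) D) i))
  truth (α ⇒ᶠ β) D i =
    decides-resp (mk⇔ id id) (Eq.sym (S-cong i (h-⇒ α β)))
      (decides-implies (sat-persistent M α) (sat-persistent M β)
        (truth α (++⁻ˡ (vars α) D)) (truth β (++⁻ʳ (vars α) D)) i)
  -- Negation is implication into the empty predicate, matched by `⊥` on the algebraic side.
  truth (¬ᶠ α) D i =
    decides-resp (mk⇔ id id) (Eq.sym (S-cong i (h-¬ α)))
      (decides-implies {Q = λ _ → Empty} (sat-persistent M α) (λ _ → id) (truth α D)
        (λ j → decides-resp (mk⇔ id id) (Eq.sym (S-⊥ j)) decides-⊥) i)
  -- The outer index `i` disappears on both sides by the two laws `s-s`, so the induction hypothesis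
  -- is used at `j`.
  truth (Sᶠ j α) D i =
    decides-resp (mk⇔ (subst (M ,_sat α) (≡.sym (s-s i j w))) (subst (M ,_sat α) (s-s i j w)))
      (Eq.sym (Eq.trans (S-cong i (h-S j α)) (S-S i j _))) (truth α D j)

-- Three truth values and the two-world model

data Value : Set where
  zero half one : Value

-- The values are the up-sets of the chain `𝟏 ≼ 𝟐`; `zero` is the empty one.
data Holds : Value → Index → Set where
  one  : ∀ {i} → Holds one i
  half : Holds half 𝟐

infix 4 _≼_

data _≼_ : Index → Index → Set where
  𝟏≼  : ∀ {i} → 𝟏 ≼ i
  𝟐≼𝟐 : 𝟐 ≼ 𝟐

≼-refl : ∀ {i} → i ≼ i
≼-refl {𝟏} = 𝟏≼
≼-refl {𝟐} = 𝟐≼𝟐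

≼-trans : ∀ {i j k} → i ≼ j → j ≼ k → i ≼ k
≼-trans 𝟏≼ _ = 𝟏≼
≼-trans 𝟐≼𝟐 𝟐≼𝟐 = 𝟐≼𝟐

holds-persistent : ∀ {v i j} → i ≼ j → Holds v i → Holds v j
holds-persistent _ one = one
holds-persistent 𝟐≼𝟐 half = half

chainFrame : ∀ ℓ → HTFrame ℓ
chainFrame ℓ = record
  { W        = Lift ℓ Index
  ; nonempty = lift 𝟏
  ; R        = λ i j → Lift ℓ (lower i ≼ lower j)
  ; s        = λ i _ → lift i
  ; R-refl   = lift ≼-refl
  ; R-trans  = λ (lift r) (lift r′) → lift (≼-trans r r′)
  ; s-s      = λ _ _ _ → refl
  ; s₁-R     = λ _ → lift 𝟏≼
  ; R-s₂     = λ { (lift 𝟏) → lift 𝟏≼ ; (lift 𝟐) → lift 𝟐≼𝟐 }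
  ; s-R      = λ _ _ → lift ≼-refl , lift ≼-refl
  ; s-cover  = λ (lift i) → i , lift i , refl
  }

chainModel : ∀ ℓ → (VarProp → Value) → HTModel VarProp ℓ
chainModel ℓ v = record
  { frame     = chainFrame ℓ
  ; m         = λ p i → Lift ℓ (Holds (v p) (lower i))
  ; m-persist = λ _ (lift r) (lift x) → lift (holds-persistent r x)
  }

-- From relational to algebraic validity

module Completeness (_≟_ : DecidableEquality VarProp) (A : AlgebraicModel VarProp c ℓ₁ ℓ₂) where
  open AlgebraicModel A renaming (trans to ≤-trans; refl to ≤-refl)
  open HTAlgebraProperties algebra

  Describes : Carrier → Value → Carrier → Set _
  Describes d v a = ∀ i → Decides d (Holds v i) (S i a)

  -- Splitting on `S 𝟏 a` and then `S 𝟐 a` gives three cases, not four, because `S₁≤S₂` settles the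
  -- second when the first holds.
  by-value : ∀ {d x} a → (∀ v e → e ≤ d → Describes e v a → e ≤ x) → d ≤ x
  by-value {d} a below = case-split (S-complemented 𝟏 a)
    (below one _ (x∧y≤x _ _) λ
      { 𝟏 → inj₁ (one , x∧y≤y _ _)
      ; 𝟐 → inj₁ (one , ≤-trans (x∧y≤y _ _) (S₁≤S₂ a)) })
    (case-split (S-complemented 𝟐 a)
      (below half _ (≤-trans (x∧y≤x _ _) (x∧y≤x _ _)) λ
        { 𝟏 → inj₂ ((λ ()) , ≤-trans (x∧y≤x _ _) (x∧y≤y _ _))
        ; 𝟐 → inj₁ (half , x∧y≤y _ _) })
      (below zero _ (≤-trans (x∧y≤x _ _) (x∧y≤x _ _)) λ
        { 𝟏 → inj₂ ((λ ()) , ≤-trans (x∧y≤x _ _) (x∧y≤y _ _))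
        ; 𝟐 → inj₂ ((λ ()) , x∧y≤y _ _) }))

  _[_≔_] : (VarProp → Value) → VarProp → Value → VarProp → Value
  (v [ p ≔ t ]) q with q ≟ p
  ... | yes _ = t
  ... | no  _ = v q

  -- If `q` is `p`, the new description replaces the old one, so repeated variables in the list do
  -- no harm.
  describes-update : ∀ {v t p q e} → Describes e t (h (var p)) → Describes e (v q) (h (var q)) →
                     Describes e ((v [ p ≔ t ]) q) (h (var q))
  describes-update {p = p} {q} D E with q ≟ p
  ... | yes refl = D
  ... | no  _    = E

  -- This is the finite join over valuations in continuation form: bounding each described part of
  -- `d` bounds `d`, without the join being written out.
  by-valuation : ∀ {d x} ps →
    (∀ v e → e ≤ d → All (λ p → Describes e (v p) (h (var p))) ps → e ≤ x) → d ≤ x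
  -- No variable is constrained yet, so the starting valuation is arbitrary; later updates overwrite
  -- it.
  by-valuation [] below = below (λ _ → zero) _ ≤-refl []
  by-valuation (p ∷ ps) below = by-valuation ps λ v e e≤d E →
    by-value (h (var p)) λ t f f≤e D →
      let F = All.map (λ D′ i → decides-antitone f≤e (D′ i)) E in
      below (v [ p ≔ t ]) f (≤-trans f≤e e≤d)
        (describes-p v D ∷ All.map (describes-update {v} D) F)
    where
    describes-p : ∀ {t e} v → Describes e t (h (var p)) → Describes e ((v [ p ≔ t ]) p) (h (var p))
    describes-p v D with p ≟ p
    ... | yes _  = D
    ... | no p≢p = contradiction refl p≢p

  complete : ∀ α → RelationallyValid ℓ α → h α ≈ ⊤
  complete {ℓ} α valid = antisym (maximum _) (by-valuation (vars α) λ v e _ E →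
    -- Index `𝟏` is used because `S 𝟏 (h α) ≤ h α`. The negative alternative contradicts validity in
    -- the chain model.
    [ (λ (_ , e≤S₁α) → ≤-trans e≤S₁α (S₁≤ _)) , (λ (¬sat , _) → contradiction (valid _ _) ¬sat) ]′
      (TruthLemma.truth (chainModel ℓ v) (lift 𝟏) A α
        (All.map (λ D i → decides-resp (mk⇔ lift lower) Eq.refl (D i)) E) 𝟏))

-- The three-element HT-algebra

infix  4 _⊑_
infixr 7 _⊓_
infixr 6 _⊔_
infixr 5 _⇒_

data _⊑_ : Value → Value → Set where
  zero⊑     : ∀ {x} → zero ⊑ x
  half⊑half : half ⊑ half
  ⊑one      : ∀ {x} → x ⊑ one

-- Minimum, maximum and Gödel implication on the chain `zero`, `half`, `one`.
_⊓_ _⊔_ _⇒_ : Value → Value → Value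

zero ⊓ _    = zero
half ⊓ zero = zero
half ⊓ _    = half
one  ⊓ y    = y

zero ⊔ y    = y
half ⊔ one  = one
half ⊔ _    = half
one  ⊔ _    = one

zero ⇒ _    = one
half ⇒ zero = zero
half ⇒ _    = one
one  ⇒ y    = y

-- `σ 𝟏` rounds down (the Baaz Delta) and `σ 𝟐` rounds up (double negation).
σ : Index → Value → Value
σ _ zero = zero
σ 𝟏 half = zero
σ 𝟐 half = one
σ _ one  = one

⊑-refl : ∀ {x} → x ⊑ x
⊑-refl {zero} = zero⊑
⊑-refl {half} = half⊑half
⊑-refl {one}  = ⊑one

⊑-trans : ∀ {x y z} → x ⊑ y → y ⊑ z → x ⊑ z
⊑-trans zero⊑     _    = zero⊑
⊑-trans half⊑half y⊑z  = y⊑z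
⊑-trans ⊑one      ⊑one = ⊑one

⊑-antisym : ∀ {x y} → x ⊑ y → y ⊑ x → x ≡ y
⊑-antisym zero⊑     zero⊑ = refl
⊑-antisym half⊑half _     = refl
⊑-antisym ⊑one      ⊑one  = refl

x⊓y⊑x : ∀ x y → x ⊓ y ⊑ x
x⊓y⊑x zero _    = zero⊑
x⊓y⊑x half zero = zero⊑
x⊓y⊑x half half = half⊑half
x⊓y⊑x half one  = half⊑half
x⊓y⊑x one  _    = ⊑one

x⊓y⊑y : ∀ x y → x ⊓ y ⊑ y
x⊓y⊑y zero _    = zero⊑
x⊓y⊑y half zero = zero⊑
x⊓y⊑y half half = half⊑half
x⊓y⊑y half one  = ⊑one
x⊓y⊑y one  _    = ⊑-refl

⊓-greatest : ∀ {x y z} → z ⊑ x → z ⊑ y → z ⊑ x ⊓ y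
⊓-greatest zero⊑     _         = zero⊑
⊓-greatest half⊑half half⊑half = half⊑half
⊓-greatest half⊑half ⊑one      = half⊑half
⊓-greatest ⊑one      z⊑y       = z⊑y

x⊑x⊔y : ∀ x y → x ⊑ x ⊔ y
x⊑x⊔y zero _    = zero⊑
x⊑x⊔y half zero = half⊑half
x⊑x⊔y half half = half⊑half
x⊑x⊔y half one  = ⊑one
x⊑x⊔y one  _    = ⊑one

y⊑x⊔y : ∀ x y → y ⊑ x ⊔ y
y⊑x⊔y zero _    = ⊑-refl
y⊑x⊔y half zero = zero⊑
y⊑x⊔y half half = half⊑half
y⊑x⊔y half one  = ⊑one
y⊑x⊔y one  _    = ⊑one

⊔-least : ∀ {x y z} → x ⊑ z → y ⊑ z → x ⊔ y ⊑ z
⊔-least zero⊑     y⊑z       = y⊑z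
⊔-least half⊑half zero⊑     = half⊑half
⊔-least half⊑half half⊑half = half⊑half
⊔-least ⊑one      _         = ⊑one

-- The cases absent from the table would need a premise `half ⊑ zero`, which is empty.
⇒-intro : ∀ w x y → w ⊓ x ⊑ y → w ⊑ x ⇒ y
⇒-intro _    zero _    _ = ⊑one
⇒-intro zero _    _    _ = zero⊑
⇒-intro half half half _ = ⊑one
⇒-intro half half one  _ = ⊑one
⇒-intro half one  _    r = r
⇒-intro one  half half _ = ⊑one
⇒-intro one  half one  _ = ⊑one
⇒-intro one  one  _    r = r

⇒-elim : ∀ w x y → w ⊑ x ⇒ y → w ⊓ x ⊑ y
⇒-elim zero _    _    _ = zero⊑
⇒-elim half zero _    _ = zero⊑
⇒-elim half half half _ = half⊑half
⇒-elim half half one  _ = ⊑one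
⇒-elim half one  _    r = r
⇒-elim one  zero _    _ = zero⊑
⇒-elim one  half half _ = half⊑half
⇒-elim one  half one  _ = ⊑one
⇒-elim one  one  _    r = r

valueHeytingAlgebra : ∀ c ℓ₁ ℓ₂ → HeytingAlgebra c ℓ₁ ℓ₂
valueHeytingAlgebra c ℓ₁ ℓ₂ = record
  { Carrier = Lift c Value
  ; _≈_     = λ x y → Lift ℓ₁ (lower x ≡ lower y)
  ; _≤_     = λ x y → Lift ℓ₂ (lower x ⊑ lower y)
  ; _∨_     = λ x y → lift (lower x ⊔ lower y)
  ; _∧_     = λ x y → lift (lower x ⊓ lower y)
  ; _⇨_     = λ x y → lift (lower x ⇒ lower y)
  ; ⊤       = lift one
  ; ⊥       = lift zero
  ; isHeytingAlgebra = record
    { isBoundedLattice = record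
      { isLattice = record
        { isPartialOrder = record
          { isPreorder = record
            { isEquivalence = record
              { refl  = lift refl
              ; sym   = λ (lift e) → lift (≡.sym e)
              ; trans = λ (lift e) (lift f) → lift (≡.trans e f)
              }
            ; reflexive = λ { (lift refl) → lift ⊑-refl }
            ; trans     = λ (lift r) (lift t) → lift (⊑-trans r t)
            }
          ; antisym = λ (lift r) (lift t) → lift (⊑-antisym r t)
          }
        ; supremum = λ (lift x) (lift y) →
            lift (x⊑x⊔y x y) , lift (y⊑x⊔y x y) , λ _ (lift r) (lift t) → lift (⊔-least r t)
        ; infimum = λ (lift x) (lift y) →
            lift (x⊓y⊑x x y) , lift (x⊓y⊑y x y) , λ _ (lift r) (lift t) → lift (⊓-greatest r t)
        }
      ; maximum = λ _ → lift ⊑one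
      ; minimum = λ _ → lift zero⊑
      }
    ; exponential = λ (lift w) (lift x) (lift y) →
        (λ (lift r) → lift (⇒-intro w x y r)) , (λ (lift r) → lift (⇒-elim w x y r))
    }
  }

σ-⊓ : ∀ i x y → σ i (x ⊓ y) ≡ σ i x ⊓ σ i y
σ-⊓ _ zero _    = refl
σ-⊓ 𝟏 half zero = refl
σ-⊓ 𝟏 half half = refl
σ-⊓ 𝟏 half one  = refl
σ-⊓ 𝟐 half zero = refl
σ-⊓ 𝟐 half half = refl
σ-⊓ 𝟐 half one  = refl
σ-⊓ 𝟏 one  _    = refl
σ-⊓ 𝟐 one  _    = refl

σ-⊔ : ∀ i x y → σ i (x ⊔ y) ≡ σ i x ⊔ σ i y
σ-⊔ _ zero _    = refl
σ-⊔ 𝟏 half zero = refl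
σ-⊔ 𝟏 half half = refl
σ-⊔ 𝟏 half one  = refl
σ-⊔ 𝟐 half zero = refl
σ-⊔ 𝟐 half half = refl
σ-⊔ 𝟐 half one  = refl
σ-⊔ 𝟏 one  _    = refl
σ-⊔ 𝟐 one  _    = refl

σ₂-⇒ : ∀ x y → σ 𝟐 (x ⇒ y) ≡ (σ 𝟐 x ⇒ σ 𝟐 y)
σ₂-⇒ zero _    = refl
σ₂-⇒ half zero = refl
σ₂-⇒ half half = refl
σ₂-⇒ half one  = refl
σ₂-⇒ one  _    = refl

σ₁-⇒ : ∀ x y → σ 𝟏 (x ⇒ y) ≡ (σ 𝟏 x ⇒ σ 𝟏 y) ⊓ (σ 𝟐 x ⇒ σ 𝟐 y)
σ₁-⇒ zero _    = refl
σ₁-⇒ half zero = refl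
σ₁-⇒ half half = refl
σ₁-⇒ half one  = refl
σ₁-⇒ one  zero = refl
σ₁-⇒ one  half = refl
σ₁-⇒ one  one  = refl

σ-σ : ∀ i j x → σ i (σ j x) ≡ σ j x
σ-σ _ _ zero = refl
σ-σ _ 𝟏 half = refl
σ-σ 𝟏 𝟐 half = refl
σ-σ 𝟐 𝟐 half = refl
σ-σ 𝟏 𝟏 one  = refl
σ-σ 𝟏 𝟐 one  = refl
σ-σ 𝟐 𝟏 one  = refl
σ-σ 𝟐 𝟐 one  = refl

σ₁-⊔ : ∀ x → σ 𝟏 x ⊔ x ≡ x
σ₁-⊔ zero = refl
σ₁-⊔ half = refl
σ₁-⊔ one  = refl

σ₁-lem : ∀ x → σ 𝟏 x ⊔ (σ 𝟏 x ⇒ zero) ≡ one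
σ₁-lem zero = refl
σ₁-lem half = refl
σ₁-lem one  = refl

valueAlgebra : ∀ c ℓ₁ ℓ₂ → HTAlgebra c ℓ₁ ℓ₂
valueAlgebra c ℓ₁ ℓ₂ = record
  { heytingAlgebra = valueHeytingAlgebra c ℓ₁ ℓ₂
  ; S      = λ i x → lift (σ i (lower x))
  ; S-cong = λ i (lift e) → lift (≡.cong (σ i) e)
  ; S-∧    = λ i x y → lift (σ-⊓ i (lower x) (lower y))
  ; S-∨    = λ i x y → lift (σ-⊔ i (lower x) (lower y))
  ; S₂-⇨   = λ x y → lift (σ₂-⇒ (lower x) (lower y))
  ; S₁-⇨   = λ x y → lift (σ₁-⇒ (lower x) (lower y))
  ; S-S    = λ i j x → lift (σ-σ i j (lower x))
  ; S₁-∨   = λ x → lift (σ₁-⊔ (lower x))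
  ; S₁-lem = λ x → lift (σ₁-lem (lower x))
  }

⟦_⟧ : For VarProp → (VarProp → Value) → Value
⟦ var p ⟧ v  = v p
⟦ α ∧ᶠ β ⟧ v = ⟦ α ⟧ v ⊓ ⟦ β ⟧ v
⟦ α ∨ᶠ β ⟧ v = ⟦ α ⟧ v ⊔ ⟦ β ⟧ v
⟦ α ⇒ᶠ β ⟧ v = ⟦ α ⟧ v ⇒ ⟦ β ⟧ v
⟦ ¬ᶠ α ⟧ v   = ⟦ α ⟧ v ⇒ zero
⟦ Sᶠ i α ⟧ v = σ i (⟦ α ⟧ v)

valueModel : ∀ c ℓ₁ ℓ₂ → (VarProp → Value) → AlgebraicModel VarProp c ℓ₁ ℓ₂
valueModel c ℓ₁ ℓ₂ v = record
  { algebra = valueAlgebra c ℓ₁ ℓ₂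
  ; h   = λ α → lift (⟦ α ⟧ v)
  ; h-∧ = λ _ _ → lift refl
  ; h-∨ = λ _ _ → lift refl
  ; h-⇒ = λ _ _ → lift refl
  ; h-¬ = λ _ → lift refl
  ; h-S = λ _ _ → lift refl
  }

-- From algebraic to relational validity

module Soundness (em : ExcludedMiddle ℓ) (M : HTModel VarProp ℓ) (w : HTModel.W M) where
  open HTModel M

  -- Meant for truth at `s 𝟏 w` and `s 𝟐 w`. By persistence the first implies the second, so the
  -- second matters only when the first fails.
  fromDecs : {P Q : Set ℓ} → Dec P → Dec Q → Value
  fromDecs (yes _) _       = one
  fromDecs (no _)  (yes _) = half
  fromDecs (no _)  (no _)  = zero

  valuation : VarProp → Value
  valuation p = fromDecs (em {P = m p (s 𝟏 w)}) (em {P = m p (s 𝟐 w)})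

  module _ (c ℓ₁ ℓ₂ : Level) where
    open TruthLemma M w (valueModel c ℓ₁ ℓ₂ valuation)

    valuation-correct : ∀ p → DecidesAt (lift one) (m p) (lift (valuation p))
    valuation-correct p i with em {P = m p (s 𝟏 w)} | em {P = m p (s 𝟐 w)}
    valuation-correct p 𝟏 | yes a | _     = inj₁ (a , lift ⊑one)
    valuation-correct p 𝟐 | yes a | _     =
      inj₁ (m-persist p (HTFrameProperties.s₁-R-s₂ frame w) a , lift ⊑one)
    valuation-correct p 𝟏 | no ¬a | yes _ = inj₂ (¬a , lift ⊑one)
    valuation-correct p 𝟐 | no _  | yes b = inj₁ (b , lift ⊑one)
    valuation-correct p 𝟏 | no ¬a | no _  = inj₂ (¬a , lift ⊑one)
    valuation-correct p 𝟐 | no _  | no ¬b = inj₂ (¬b , lift ⊑one)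

    sound : ∀ α → AlgebraicallyValid c ℓ₁ ℓ₂ α → M , w sat α
    sound α valid
      with ⟦ α ⟧ valuation | valid (valueModel c ℓ₁ ℓ₂ valuation)
         | truth α (All.universal valuation-correct (vars α)) 𝟏
    -- Truth at `s 𝟏 w` passes to `w` by persistence.
    ... | _ | lift refl | inj₁ (sat , _)     = sat-persistent M α (s₁-R w) sat
    -- Validity makes the value `one`, whose complement under `σ 𝟏` is `zero`; the alternative would
    -- give `one ⊑ zero`.
    ... | _ | lift refl | inj₂ (_ , lift ())

theorem5p6 : ∀ {ℓ c ℓ₁ ℓ₂ : Level} → ExcludedMiddle ℓ →
    (VarProp : Set) → VarProp ↣ ℕ →
    (α : For VarProp) → RelationallyValid ℓ α ⇔ AlgebraicallyValid c ℓ₁ ℓ₂ α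
theorem5p6 {c = c} {ℓ₁} {ℓ₂} em _ VarProp↣ℕ α = mk⇔
  -- Countability enters as decidable equality of variables, on which updating a valuation relies.
  (λ valid A → Completeness.complete (via-injection VarProp↣ℕ ℕ._≟_) A α valid)
  (λ valid M w → Soundness.sound em M w c ℓ₁ ℓ₂ α valid)
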